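{- In $\mathsf{ZF}$, the following statements are equivalent: (1) $\mathsf{DC}$. (2) If $G=(V_{G},E_{G})$ is an infinite graph, then for every coloring $f:[V_{G}]^{2}\to\{0,1\}$, if all $0$-monochromatic sets are finite, then there is a maximal $0$-monochromatic set. (3) For every infinite graph $G$, if all independent sets of $G$ are finite, then there exists a maximal independent set of $G$.
   Context: $\mathsf{ZF}$ is Zermelo–Fraenkel set theory without the Axiom of Choice. $[V]^{2}$ is the set of $2$-element subsets of $V$. A graph $G=(V_{G},E_{G})$ consists of a set $V_{G}$ of vertices and a set $E_{G}\subseteq[V_{G}]^{2}$ of edges; it is infinite if $V_G$ is infinite. An independent set of $G$ is a set of vertices no two of which are adjacent; a maximal independent set is an independent set that is not a proper subset of any other independent set. For $f:[V_{G}]^{2}\to\{0,1\}$, a set $Y\subseteq V_{G}$ is $0$-monochromatic if $f(e)=0$ for all $e\in[Y]^{2}$; maximal means maximal with respect to inclusion. $\mathsf{DC}$ (Principle of Dependent Choices): if $S$ is a non-empty set and $R$ is a binary relation on $S$ such that $(\forall x\in S)(\exists y\in S)(x\,R\,y)$, then there is a sequence $(x_{n})_{n\in\omega}$ of elements of $S$ with $x_{n}\,R\,x_{n+1}$ for all $n\in\omega$. -}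

module Defs where

open import Data.Fin.Base using (Fin)
open import Data.Fin.Patterns using (0F; 1F; 2F; 3F)
open import Data.Nat.Base using (ℕ; suc)
open import Data.Product using (∃; ∃!; _×_; _,_; proj₁; proj₂)
open import Data.Sum.Base using (_⊎_)
open import Data.Vec.Base using (Vec; []; _∷_; lookup)
open import Function.Bundles using (_⇔_)
open import Level using (Level) renaming (suc to lsuc)
open import Relation.Binary.PropositionalEquality using (_≡_)
open import Relation.Nullary using (¬_)

-- First-order formulas of the language {∈, =}, with free variables in Fin n
-- (de Bruijn indices: a quantifier binds index 0).

infix  8 _∈′_ _≐_
infix  7 ¬′_
infixr 6 _∧′_
infixr 5 _∨′_
infixr 4 _⇒′_
infix  3 _⇔′_
infixr 2 ∀′_ ∃′_

data Formula : ℕ → Set where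
  _∈′_ _≐_                : ∀ {n} → Fin n → Fin n → Formula n
  ¬′_                     : ∀ {n} → Formula n → Formula n
  _∧′_ _∨′_ _⇒′_ _⇔′_     : ∀ {n} → Formula n → Formula n → Formula n
  ∀′_ ∃′_                 : ∀ {n} → Formula (suc n) → Formula n

module Membership {ℓ : Level} {U : Set ℓ} (_∈_ : U → U → Set ℓ) where

  Sat : ∀ {n} → Formula n → Vec U n → Set ℓ
  Sat (i ∈′ j) ρ = lookup ρ i ∈ lookup ρ j
  Sat (i ≐ j)  ρ = lookup ρ i ≡ lookup ρ j
  Sat (¬′ φ)   ρ = ¬ Sat φ ρ
  Sat (φ ∧′ ψ) ρ = Sat φ ρ × Sat ψ ρ
  Sat (φ ∨′ ψ) ρ = Sat φ ρ ⊎ Sat ψ ρ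
  Sat (φ ⇒′ ψ) ρ = Sat φ ρ → Sat ψ ρ
  Sat (φ ⇔′ ψ) ρ = Sat φ ρ ⇔ Sat ψ ρ
  Sat (∀′ φ)   ρ = ∀ x → Sat φ (x ∷ ρ)
  Sat (∃′ φ)   ρ = ∃ λ x → Sat φ (x ∷ ρ)

  infix 4 _⊆_ _⊊_

  _⊆_ _⊊_ : U → U → Set ℓ
  x ⊆ y = ∀ z → z ∈ x → z ∈ y
  x ⊊ y = x ⊆ y × ¬ (x ≡ y)

  IsEmpty : U → Set ℓ
  IsEmpty e = ∀ z → ¬ (z ∈ e)

  -- s = x ∪ {x}
  IsSuccessor : U → U → Set ℓ
  IsSuccessor s x = ∀ z → z ∈ s ⇔ (z ∈ x ⊎ z ≡ x)

  Inductive : U → Set ℓ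
  Inductive I = (∃ λ e → e ∈ I × IsEmpty e)
              × (∀ x → x ∈ I → ∃ λ s → s ∈ I × IsSuccessor s x)

  TwoElement : U → Set ℓ
  TwoElement z = ∃ λ x → ∃ λ y → ¬ (x ≡ y) × (∀ w → w ∈ z ⇔ (w ≡ x ⊎ w ≡ y))

  Maximal : (U → Set ℓ) → U → Set ℓ
  Maximal P Y = P Y × (∀ Z → P Z → ¬ (Y ⊊ Z))

-- A first-order model of ZF.  Agda's logic is constructive, so that the model
-- obeys classical logic is stated as the schema `excludedMiddle`.  The
-- separation and replacement schemas range over first-order formulas with
-- parameters, not over arbitrary Agda predicates on U.

record ZF (ℓ : Level) : Set (lsuc ℓ) where
  infix 4 _∈_
  field
    U   : Set ℓ
    _∈_ : U → U → Set ℓ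

  open Membership _∈_ public

  field
    excludedMiddle : ∀ {n} (φ : Formula n) (ρ : Vec U n) → Sat (φ ∨′ ¬′ φ) ρ

    extensionality : ∀ x y → (∀ z → z ∈ x ⇔ z ∈ y) → x ≡ y
    foundation     : ∀ x → (∃ λ y → y ∈ x) →
                     ∃ λ y → y ∈ x × (∀ z → z ∈ y → ¬ (z ∈ x))
    pairing        : ∀ x y → ∃ λ p → ∀ z → z ∈ p ⇔ (z ≡ x ⊎ z ≡ y)
    union          : ∀ x → ∃ λ u → ∀ z → z ∈ u ⇔ (∃ λ y → y ∈ x × z ∈ y)
    powerSet       : ∀ x → ∃ λ p → ∀ z → z ∈ p ⇔ z ⊆ x
    infinity       : ∃ λ I → Inductive I
    separation     : ∀ {n} (φ : Formula (suc n)) (ρ : Vec U n) a →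
                     ∃ λ b → ∀ z → z ∈ b ⇔ (z ∈ a × Sat φ (z ∷ ρ))
    replacement    : ∀ {n} (φ : Formula (suc (suc n))) (ρ : Vec U n) a →
                     (∀ x → x ∈ a → ∀ y y′ →
                        Sat φ (x ∷ y ∷ ρ) → Sat φ (x ∷ y′ ∷ ρ) → y ≡ y′) →
                     ∃ λ b → ∀ y → y ∈ b ⇔ (∃ λ x → x ∈ a × Sat φ (x ∷ y ∷ ρ))

module _ {ℓ : Level} (M : ZF ℓ) where
  open ZF M

  ∅ : U
  ∅ = proj₁ (separation (¬′ (0F ≐ 0F)) [] (proj₁ infinity))

  ｛_,_｝ : U → U → U
  ｛ x , y ｝ = proj₁ (pairing x y)

  ⟨_,_⟩ : U → U → U
  ⟨ x , y ⟩ = ｛ ｛ x , x ｝ , ｛ x , y ｝ ｝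

  ⋃ : U → U
  ⋃ x = proj₁ (union x)

  𝒫 : U → U
  𝒫 x = proj₁ (powerSet x)

  succ : U → U
  succ x = ⋃ ｛ x , ｛ x , x ｝ ｝

  𝟎 𝟏 : U
  𝟎 = ∅
  𝟏 = succ ∅

  inductive′ : ∀ {n} → Formula (suc n)
  inductive′ = (∃′ 0F ∈′ 1F ∧′ (∀′ ¬′ (0F ∈′ 1F)))
            ∧′ (∀′ 0F ∈′ 1F ⇒′ (∃′ 0F ∈′ 2F ∧′ (∀′ 0F ∈′ 1F ⇔′ (0F ∈′ 2F ∨′ 0F ≐ 2F))))

  ω : U
  ω = proj₁ (separation (∀′ inductive′ ⇒′ 1F ∈′ 0F) [] (proj₁ infinity))

  ω-spec : ∀ n → n ∈ ω ⇔ (n ∈ proj₁ infinity × (∀ I → Inductive I → n ∈ I))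
  ω-spec = proj₂ (separation (∀′ inductive′ ⇒′ 1F ∈′ 0F) [] (proj₁ infinity))

  twoElement′ : Formula 1
  twoElement′ = ∃′ ∃′ ¬′ (1F ≐ 0F) ∧′ (∀′ 0F ∈′ 3F ⇔′ (0F ≐ 2F ∨′ 0F ≐ 1F))

  [_]² : U → U
  [ v ]² = proj₁ (separation twoElement′ [] (𝒫 v))

  []²-spec : ∀ v z → z ∈ [ v ]² ⇔ (z ∈ 𝒫 v × TwoElement z)
  []²-spec v = proj₂ (separation twoElement′ [] (𝒫 v))

  IsRelation : U → U → U → Set ℓ
  IsRelation r a b = ∀ p → p ∈ r → ∃ λ x → ∃ λ y → x ∈ a × y ∈ b × p ≡ ⟨ x , y ⟩

  IsFunction : U → U → U → Set ℓ
  IsFunction f a b = IsRelation f a b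
                   × (∀ x → x ∈ a → ∃! _≡_ λ y → ⟨ x , y ⟩ ∈ f)

  IsBijection : U → U → U → Set ℓ
  IsBijection f a b = IsFunction f a b
                    × (∀ y → y ∈ b → ∃! _≡_ λ x → ⟨ x , y ⟩ ∈ f)

  Finite : U → Set ℓ
  Finite x = ∃ λ n → n ∈ ω × (∃ λ f → IsBijection f n x)

  DC : Set ℓ
  DC = ∀ S R → (∃ λ x → x ∈ S) → IsRelation R S S →
       (∀ x → x ∈ S → ∃ λ y → y ∈ S × ⟨ x , y ⟩ ∈ R) →
       ∃ λ s → IsFunction s ω S ×
         (∀ n x y → n ∈ ω → ⟨ n , x ⟩ ∈ s → ⟨ succ n , y ⟩ ∈ s → ⟨ x , y ⟩ ∈ R)

  record Graph : Set ℓ where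
    field
      vertices : U
      edges    : U
      edges⊆   : edges ⊆ [ vertices ]²

  open Graph

  Infinite : Graph → Set ℓ
  Infinite G = ¬ Finite (vertices G)

  Adjacent : Graph → U → U → Set ℓ
  Adjacent G x y = ｛ x , y ｝ ∈ edges G

  Independent : Graph → U → Set ℓ
  Independent G I = I ⊆ vertices G
                  × (∀ x y → x ∈ I → y ∈ I → ¬ (x ≡ y) → ¬ Adjacent G x y)

  ZeroMonochromatic : Graph → U → U → Set ℓ
  ZeroMonochromatic G f Y = Y ⊆ vertices G × (∀ e → e ∈ [ Y ]² → ⟨ e , 𝟎 ⟩ ∈ f)

  MaximalZeroMonochromatic : Set ℓ
  MaximalZeroMonochromatic =
    ∀ (G : Graph) → Infinite G →
    ∀ f → IsFunction f [ vertices G ]² ｛ 𝟎 , 𝟏 ｝ →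
    (∀ Y → ZeroMonochromatic G f Y → Finite Y) →
    ∃ λ Y → Maximal (ZeroMonochromatic G f) Y

  MaximalIndependent : Set ℓ
  MaximalIndependent =
    ∀ (G : Graph) → Infinite G →
    (∀ I → Independent G I → Finite I) →
    ∃ λ I → Maximal (Independent G) I

{-# OPTIONS --safe #-}

-- Given DC, a coloring without maximal 0-monochromatic set yields a strictly
-- increasing ω-chain of such sets; its union is 0-monochromatic, hence finite,
-- hence contained in a single member of the chain, which is absurd.
--
-- Conversely, join two finite R-paths in S by an edge when neither extends the
-- other, so that independent sets are chains of paths.  The union of an unbounded
-- chain is the sequence DC asks for.  If there is no unbounded chain, every chain
-- lies below a single path and so is finite, and there is a maximal one; but
-- that cannot lie below a path, because every path extends by totality of R.
module Submission where

open import Data.Empty using (⊥-elim)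
open import Data.Fin.Base using (Fin; suc)
open import Data.Fin.Patterns using (0F; 1F; 2F; 3F; 4F; 5F; 6F)
open import Data.Nat.Base using (ℕ) renaming (suc to 1+_)
open import Data.Product using (∃; ∃!; _×_; _,_; proj₁; proj₂)
import Data.Product as Product
open import Data.Sum.Base using (_⊎_; inj₁; inj₂)
import Data.Sum.Base as Sum
open import Data.Vec.Base using (Vec; []; _∷_; lookup)
open import Function.Base using (_∘_; id)
open import Function.Bundles using (_⇔_; mk⇔; module Equivalence)
import Function.Properties.Equivalence as ⇔
open import Level using (Level)
open import Relation.Binary.PropositionalEquality using (_≡_; refl; sym; trans; subst)
open import Relation.Nullary using (¬_)
open import Defs

open Equivalence using (to; from)

module _ {ℓ : Level} (M : ZF ℓ) where
  open ZF M

  -- Definable predicates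

  -- Excluded middle, separation and replacement are available only for formulas, so each predicate
  -- that they are applied to carries a formula and a proof that satisfaction agrees with it.
  record Def {n} (P : Vec U n → Set ℓ) : Set ℓ where
    constructor _by_
    field
      formula : Formula n
      correct : ∀ ρ → Sat formula ρ ⇔ P ρ

  private variable
    n : ℕ
    P Q : Vec U n → Set ℓ

  infix  8 _∈ᵈ_ _≡ᵈ_ _⊆ᵈ_ _⊊ᵈ_
  infix  7 ¬ᵈ_
  infixr 6 _∧ᵈ_
  infixr 5 _∨ᵈ_
  infixr 4 _⇒ᵈ_
  infix  3 _⇔ᵈ_
  infixr 2 ∀ᵈ_ ∃ᵈ_

  -- Opaque, because `with` normalises its scrutinee and formulas grow large.
  opaque
    _∈ᵈ_ : (i j : Fin n) → Def λ ρ → lookup ρ i ∈ lookup ρ j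
    i ∈ᵈ j = (i ∈′ j) by λ _ → ⇔.refl

    _≡ᵈ_ : (i j : Fin n) → Def λ ρ → lookup ρ i ≡ lookup ρ j
    i ≡ᵈ j = (i ≐ j) by λ _ → ⇔.refl

    ¬ᵈ_ : Def P → Def λ ρ → ¬ P ρ
    ¬ᵈ (φ by c) = (¬′ φ) by λ ρ → mk⇔ (_∘ from (c ρ)) (_∘ to (c ρ))

    _∧ᵈ_ : Def P → Def Q → Def λ ρ → P ρ × Q ρ
    (φ by c) ∧ᵈ (ψ by d) = (φ ∧′ ψ) by λ ρ →
      mk⇔ (Product.map (to (c ρ)) (to (d ρ))) (Product.map (from (c ρ)) (from (d ρ)))

    _∨ᵈ_ : Def P → Def Q → Def λ ρ → P ρ ⊎ Q ρ
    (φ by c) ∨ᵈ (ψ by d) = (φ ∨′ ψ) by λ ρ →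
      mk⇔ (Sum.map (to (c ρ)) (to (d ρ))) (Sum.map (from (c ρ)) (from (d ρ)))

    _⇒ᵈ_ : Def P → Def Q → Def λ ρ → P ρ → Q ρ
    (φ by c) ⇒ᵈ (ψ by d) = (φ ⇒′ ψ) by λ ρ →
      mk⇔ (λ h → to (d ρ) ∘ h ∘ from (c ρ)) (λ h → from (d ρ) ∘ h ∘ to (c ρ))

    _⇔ᵈ_ : Def P → Def Q → Def λ ρ → P ρ ⇔ Q ρ
    (φ by c) ⇔ᵈ (ψ by d) = (φ ⇔′ ψ) by λ ρ →
      mk⇔ (λ h → ⇔.trans (⇔.sym (c ρ)) (⇔.trans h (d ρ)))
          (λ h → ⇔.trans (c ρ) (⇔.trans h (⇔.sym (d ρ))))

    ∀ᵈ_ : {P : Vec U (1+ n) → Set ℓ} → Def P → Def λ ρ → ∀ x → P (x ∷ ρ)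
    ∀ᵈ (φ by c) = (∀′ φ) by λ ρ →
      mk⇔ (λ h x → to (c (x ∷ ρ)) (h x)) (λ h x → from (c (x ∷ ρ)) (h x))

    ∃ᵈ_ : {P : Vec U (1+ n) → Set ℓ} → Def P → Def λ ρ → ∃ λ x → P (x ∷ ρ)
    ∃ᵈ (φ by c) = (∃′ φ) by λ ρ →
      mk⇔ (Product.map₂ (to (c _))) (Product.map₂ (from (c _)))

    -- Keeps the formula and exchanges the predicate for an equivalent one. This is how pairs,
    -- successors and power sets, for which formulas have no terms, enter definable predicates.
    via : Def P → (∀ ρ → P ρ ⇔ Q ρ) → Def Q
    via (φ by c) e = φ by λ ρ → ⇔.trans (c ρ) (e ρ)

    _⊆ᵈ_ : (i j : Fin n) → Def λ ρ → lookup ρ i ⊆ lookup ρ j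
    i ⊆ᵈ j = ∀ᵈ 0F ∈ᵈ suc i ⇒ᵈ 0F ∈ᵈ suc j

    _⊊ᵈ_ : (i j : Fin n) → Def λ ρ → lookup ρ i ⊊ lookup ρ j
    i ⊊ᵈ j = (i ⊆ᵈ j) ∧ᵈ (¬ᵈ (i ≡ᵈ j))

    em : Def P → ∀ ρ → P ρ ⊎ ¬ P ρ
    em (φ by c) ρ = Sum.map (to (c ρ)) (_∘ from (c ρ)) (excludedMiddle φ ρ)

    separate : {P : Vec U (1+ n) → Set ℓ} → Def P → ∀ ρ a →
               ∃ λ b → ∀ z → z ∈ b ⇔ (z ∈ a × P (z ∷ ρ))
    separate (φ by c) ρ a with separation φ ρ a
    ... | b , spec = b , λ z → ⇔.trans (spec z)
      (mk⇔ (Product.map₂ (to (c (z ∷ ρ)))) (Product.map₂ (from (c (z ∷ ρ)))))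

  -- Pairs, insertion and relations

  infix 9 ⟪_,_⟫ ⟅_,_⟆

  ⟪_,_⟫ ⟅_,_⟆ : U → U → U
  ⟪_,_⟫ = ⟨_,_⟩ M
  ⟅_,_⟆ = ｛_,_｝ M

  upair-spec : ∀ x y z → z ∈ ⟅ x , y ⟆ ⇔ (z ≡ x ⊎ z ≡ y)
  upair-spec x y = proj₂ (pairing x y)

  -- By extensionality, an equation with `a` amounts to a first-order condition on members, which a
  -- formula can express.
  characterise : {Q : U → Set ℓ} {a : U} → (∀ z → z ∈ a ⇔ Q z) →
                 ∀ p → (∀ z → z ∈ p ⇔ Q z) ⇔ p ≡ a
  characterise {Q} spec p = mk⇔
    (λ h → extensionality _ _ λ z → ⇔.trans (h z) (⇔.sym (spec z)))
    (λ e → subst (λ u → ∀ z → z ∈ u ⇔ Q z) (sym e) spec)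

  ⊆-antisym : ∀ {x y} → x ⊆ y → y ⊆ x → x ≡ y
  ⊆-antisym x⊆y y⊆x = extensionality _ _ λ z → mk⇔ (x⊆y z) (y⊆x z)

  ≡upairᵈ : (p x y : Fin n) → Def λ ρ → lookup ρ p ≡ ⟅ lookup ρ x , lookup ρ y ⟆
  ≡upairᵈ p x y =
    via (∀ᵈ 0F ∈ᵈ suc p ⇔ᵈ (0F ≡ᵈ suc x ∨ᵈ 0F ≡ᵈ suc y))
        (λ ρ → characterise (upair-spec _ _) (lookup ρ p))

  ≡pairᵈ : (p x y : Fin n) → Def λ ρ → lookup ρ p ≡ ⟪ lookup ρ x , lookup ρ y ⟫
  ≡pairᵈ p x y =
    via (∀ᵈ 0F ∈ᵈ suc p ⇔ᵈ (≡upairᵈ 0F (suc x) (suc x) ∨ᵈ ≡upairᵈ 0F (suc x) (suc y)))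
        (λ ρ → characterise (upair-spec _ _) (lookup ρ p))

  pair∈ᵈ : (x y r : Fin n) → Def λ ρ → ⟪ lookup ρ x , lookup ρ y ⟫ ∈ lookup ρ r
  pair∈ᵈ x y r =
    via (∃ᵈ ≡pairᵈ 0F (suc x) (suc y) ∧ᵈ 0F ∈ᵈ suc r)
        (λ ρ → mk⇔ (λ (_ , e , h) → subst (_∈ lookup ρ r) e h) (λ h → _ , refl , h))

  upair-left : ∀ x y → x ∈ ⟅ x , y ⟆
  upair-left x y = from (upair-spec x y x) (inj₁ refl)

  upair-right : ∀ x y → y ∈ ⟅ x , y ⟆
  upair-right x y = from (upair-spec x y y) (inj₂ refl)

  singleton-∈ : ∀ {x z} → z ∈ ⟅ x , x ⟆ → z ≡ x
  singleton-∈ h = Sum.[ id , id ] (to (upair-spec _ _ _) h)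

  upair-singleton : ∀ {a b c} → ⟅ a , b ⟆ ≡ ⟅ c , c ⟆ → a ≡ c × b ≡ c
  upair-singleton {a} {b} {c} e =
    singleton-∈ (subst (a ∈_) e (upair-left a b)) ,
    singleton-∈ (subst (b ∈_) e (upair-right a b))

  upair-injectiveʳ : ∀ {a b d} → ⟅ a , b ⟆ ≡ ⟅ a , d ⟆ → b ≡ d
  upair-injectiveʳ {a} {b} {d} e
    with to (upair-spec a d b) (subst (b ∈_) e (upair-right a b))
       | to (upair-spec a b d) (subst (d ∈_) (sym e) (upair-right a d))
  ... | inj₂ b≡d | _        = b≡d
  ... | inj₁ _   | inj₂ d≡b = sym d≡b
  ... | inj₁ b≡a | inj₁ d≡a = trans b≡a (sym d≡a)

  pair-injectiveˡ : ∀ {a b c d} → ⟪ a , b ⟫ ≡ ⟪ c , d ⟫ → a ≡ c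
  pair-injectiveˡ {a} {b} {c} {d} e
    with to (upair-spec _ _ _) (subst (⟅ a , a ⟆ ∈_) e (upair-left _ _))
  ... | inj₁ h = proj₁ (upair-singleton h)
  ... | inj₂ h = sym (proj₁ (upair-singleton (sym h)))

  pair-injectiveʳ : ∀ {a b c d} → ⟪ a , b ⟫ ≡ ⟪ c , d ⟫ → b ≡ d
  pair-injectiveʳ {a} {b} {c} {d} e with pair-injectiveˡ e
  ... | refl
    with to (upair-spec _ _ _) (subst (⟅ a , b ⟆ ∈_) e (upair-right _ _))
       | to (upair-spec _ _ _) (subst (⟅ a , d ⟆ ∈_) (sym e) (upair-right _ _))
  ... | inj₂ h | _      = upair-injectiveʳ h
  ... | inj₁ _ | inj₂ h = sym (upair-injectiveʳ h)
  ... | inj₁ h | inj₁ k = trans (proj₂ (upair-singleton h)) (sym (proj₂ (upair-singleton k)))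

  upair-⊆ : ∀ {x y c} → x ∈ c → y ∈ c → ⟅ x , y ⟆ ⊆ c
  upair-⊆ x∈ y∈ z z∈ with to (upair-spec _ _ z) z∈
  ... | inj₁ refl = x∈
  ... | inj₂ refl = y∈

  powerSet-spec : ∀ x z → z ∈ 𝒫 M x ⇔ z ⊆ x
  powerSet-spec x = proj₂ (powerSet x)

  union-spec : ∀ x z → z ∈ ⋃ M x ⇔ (∃ λ y → y ∈ x × z ∈ y)
  union-spec x = proj₂ (union x)

  -- The set `a ∪ {x}`. By definition `insert x x` is `succ M x`, so the facts about insertion apply
  -- to successors as they stand.
  insert : U → U → U
  insert x a = ⋃ M ⟅ a , ⟅ x , x ⟆ ⟆

  insert-spec : ∀ x a z → z ∈ insert x a ⇔ (z ∈ a ⊎ z ≡ x)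
  insert-spec x a z = ⇔.trans (union-spec _ z) (mk⇔ fwd bwd)
    where
    fwd : (∃ λ y → y ∈ ⟅ a , ⟅ x , x ⟆ ⟆ × z ∈ y) → z ∈ a ⊎ z ≡ x
    fwd (y , y∈ , z∈y) with to (upair-spec _ _ y) y∈
    ... | inj₁ refl = inj₁ z∈y
    ... | inj₂ refl = inj₂ (singleton-∈ z∈y)
    bwd : z ∈ a ⊎ z ≡ x → ∃ λ y → y ∈ ⟅ a , ⟅ x , x ⟆ ⟆ × z ∈ y
    bwd (inj₁ h)    = _ , upair-left _ _ , h
    bwd (inj₂ refl) = _ , upair-right _ _ , upair-left _ _

  insert-old : ∀ {x a z} → z ∈ a → z ∈ insert x a
  insert-old h = from (insert-spec _ _ _) (inj₁ h)

  insert-new : ∀ {x a} → x ∈ insert x a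
  insert-new = from (insert-spec _ _ _) (inj₂ refl)

  opaque
    -- Kuratowski pairs with components in `a` and `b` lie in the double power set of `a ∪ b`, from
    -- which separation selects them.
    product : ∀ a b → ∃ λ c → ∀ p → p ∈ c ⇔ (∃ λ x → ∃ λ y → x ∈ a × y ∈ b × p ≡ ⟪ x , y ⟫)
    product a b with separate
        (∃ᵈ ∃ᵈ 1F ∈ᵈ 3F ∧ᵈ 0F ∈ᵈ 4F ∧ᵈ ≡pairᵈ 2F 1F 0F)
        (a ∷ b ∷ []) (𝒫 M (𝒫 M (⋃ M ⟅ a , b ⟆)))
    ... | c , spec = c , λ p → ⇔.trans (spec p) (mk⇔ proj₂ (λ h → pairs∈𝒫𝒫 p h , h))
      where
      left : ∀ {x} → x ∈ a → x ∈ ⋃ M ⟅ a , b ⟆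
      left h = from (union-spec _ _) (_ , upair-left _ _ , h)
      right : ∀ {y} → y ∈ b → y ∈ ⋃ M ⟅ a , b ⟆
      right h = from (union-spec _ _) (_ , upair-right _ _ , h)
      upair∈𝒫 : ∀ {c x y} → x ∈ c → y ∈ c → ⟅ x , y ⟆ ∈ 𝒫 M c
      upair∈𝒫 x∈ y∈ = from (powerSet-spec _ _) (upair-⊆ x∈ y∈)
      pairs∈𝒫𝒫 : ∀ p → (∃ λ x → ∃ λ y → x ∈ a × y ∈ b × p ≡ ⟪ x , y ⟫) →
                 p ∈ 𝒫 M (𝒫 M (⋃ M ⟅ a , b ⟆))
      pairs∈𝒫𝒫 p (x , y , x∈a , y∈b , refl) =
        upair∈𝒫 (upair∈𝒫 (left x∈a) (left x∈a)) (upair∈𝒫 (left x∈a) (right y∈b))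

  opaque
    -- The environment also holds the pair itself, which `P` is free to ignore.
    separateRelation : {P : Vec U (1+ 1+ 1+ n) → Set ℓ} → Def P → ∀ ρ a b →
      ∃ λ r → IsRelation M r a b ×
              (∀ x y → ⟪ x , y ⟫ ∈ r ⇔ (x ∈ a × y ∈ b × P (y ∷ x ∷ ⟪ x , y ⟫ ∷ ρ)))
    separateRelation {P = P} d ρ a b
      with separate (∃ᵈ ∃ᵈ ≡pairᵈ 2F 1F 0F ∧ᵈ d) ρ (proj₁ (product a b))
    ... | r , spec = r , (λ p h → to (prod-spec p) (proj₁ (to (spec p) h))) ,
                     λ x y → ⇔.trans (spec _) (mk⇔ (fwd x y) (bwd x y))
      where
      prod-spec : ∀ p → p ∈ proj₁ (product a b) ⇔ (∃ λ x → ∃ λ y → x ∈ a × y ∈ b × p ≡ ⟪ x , y ⟫)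
      prod-spec = proj₂ (product a b)
      Base : U → Set ℓ
      Base p = p ∈ proj₁ (product a b)
             × (∃ λ x → ∃ λ y → p ≡ ⟪ x , y ⟫ × P (y ∷ x ∷ p ∷ ρ))
      fwd : ∀ x y → Base ⟪ x , y ⟫ → x ∈ a × y ∈ b × P (y ∷ x ∷ ⟪ x , y ⟫ ∷ ρ)
      fwd x y (h , x₁ , y₁ , e₁ , p₁) with to (prod-spec _) h
      ... | x₂ , y₂ , x∈ , y∈ , e₂
        with pair-injectiveˡ e₁ | pair-injectiveʳ e₁ | pair-injectiveˡ e₂ | pair-injectiveʳ e₂
      ... | refl | refl | refl | refl = x∈ , y∈ , p₁
      bwd : ∀ x y → x ∈ a × y ∈ b × P (y ∷ x ∷ ⟪ x , y ⟫ ∷ ρ) → Base ⟪ x , y ⟫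
      bwd x y (x∈ , y∈ , p) = from (prod-spec _) (x , y , x∈ , y∈ , refl) , x , y , refl , p

  relation-∈ : ∀ {r a b x y} → IsRelation M r a b → ⟪ x , y ⟫ ∈ r → x ∈ a × y ∈ b
  relation-∈ rel h with rel _ h
  ... | _ , _ , x∈ , y∈ , e with pair-injectiveˡ e | pair-injectiveʳ e
  ... | refl | refl = x∈ , y∈

  function-unique : ∀ {f a b x y z} → IsFunction M f a b → ⟪ x , y ⟫ ∈ f → ⟪ x , z ⟫ ∈ f → y ≡ z
  function-unique (rel , tot) p q with tot _ (proj₁ (relation-∈ rel p))
  ... | _ , _ , u = trans (sym (u p)) (u q)

  function-value : ∀ {f a b x} → IsFunction M f a b → x ∈ a → ∃ λ y → ⟪ x , y ⟫ ∈ f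
  function-value (_ , tot) x∈ with tot _ x∈
  ... | y , p , _ = y , p

  insert-pair : ∀ {f x y u v} → ⟪ u , v ⟫ ∈ insert ⟪ x , y ⟫ f →
                ⟪ u , v ⟫ ∈ f ⊎ (u ≡ x × v ≡ y)
  insert-pair h =
    Sum.map₂ (λ e → pair-injectiveˡ e , pair-injectiveʳ e) (to (insert-spec _ _ _) h)

  -- Since `x` is outside the old domain, the new value cannot clash with an old one. The codomain
  -- may grow, which serves bijections; paths keep theirs fixed.
  insert-function : ∀ {f a b c x y} → IsFunction M f a b → ¬ x ∈ a → b ⊆ c → y ∈ c →
                    IsFunction M (insert ⟪ x , y ⟫ f) (insert x a) c
  insert-function {f} {a} {b} {c} {x} {y} fun@(rel , _) x∉a b⊆c y∈c = rel⁺ , tot⁺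
    where
    rel⁺ : IsRelation M (insert ⟪ x , y ⟫ f) (insert x a) c
    rel⁺ p h with to (insert-spec _ _ p) h
    ... | inj₂ refl = x , y , insert-new , y∈c , refl
    ... | inj₁ h′ with rel p h′
    ...   | u , v , u∈ , v∈ , refl = u , v , insert-old u∈ , b⊆c v v∈ , refl
    tot⁺ : ∀ u → u ∈ insert x a → ∃! _≡_ λ v → ⟪ u , v ⟫ ∈ insert ⟪ x , y ⟫ f
    tot⁺ u u∈ with to (insert-spec _ _ u) u∈
    ... | inj₂ refl = y , insert-new , λ h → Sum.[ (λ h′ → ⊥-elim (x∉a (proj₁ (relation-∈ rel h′))))
                                                 , (λ (_ , e) → sym e) ] (insert-pair h)
    ... | inj₁ u∈a with function-value fun u∈a
    ...   | v , uv = v , insert-old uv , λ h →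
      Sum.[ function-unique fun uv , (λ { (refl , _) → ⊥-elim (x∉a u∈a) }) ] (insert-pair h)

  insert-bijection : ∀ {f a b x y} → IsBijection M f a b → ¬ x ∈ a → ¬ y ∈ b →
                     IsBijection M (insert ⟪ x , y ⟫ f) (insert x a) (insert y b)
  insert-bijection {f} {a} {b} {x} {y} (fun@(rel , _) , sur) x∉a y∉b =
    insert-function fun x∉a (λ _ → insert-old) insert-new , sur⁺
    where
    sur⁺ : ∀ v → v ∈ insert y b → ∃! _≡_ λ u → ⟪ u , v ⟫ ∈ insert ⟪ x , y ⟫ f
    sur⁺ v v∈ with to (insert-spec _ _ v) v∈
    ... | inj₂ refl = x , insert-new , λ h → Sum.[ (λ h′ → ⊥-elim (y∉b (proj₂ (relation-∈ rel h′))))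
                                                 , (λ (e , _) → sym e) ] (insert-pair h)
    ... | inj₁ v∈b with sur v v∈b
    ...   | u , uv , unique = u , insert-old uv , λ h →
      Sum.[ unique , (λ { (_ , refl) → ⊥-elim (y∉b v∈b) }) ] (insert-pair h)

  -- Natural numbers

  ∈-irrefl : ∀ {x} → ¬ x ∈ x
  ∈-irrefl {x} h with foundation ⟅ x , x ⟆ (x , upair-left x x)
  ... | y , y∈ , min with singleton-∈ y∈
  ... | refl = min x h (upair-left x x)

  ∈-asym : ∀ {x y} → x ∈ y → ¬ y ∈ x
  ∈-asym {x} {y} x∈y y∈x with foundation ⟅ x , y ⟆ (x , upair-left x y)
  ... | z , z∈ , min with to (upair-spec x y z) z∈
  ... | inj₁ refl = min y y∈x (upair-right x y)
  ... | inj₂ refl = min x x∈y (upair-left x y)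

  succ-injective : ∀ {x y} → succ M x ≡ succ M y → x ≡ y
  succ-injective {x} {y} e
    with to (insert-spec y y x) (subst (x ∈_) e insert-new)
       | to (insert-spec x x y) (subst (y ∈_) (sym e) insert-new)
  ... | inj₂ x≡y | _        = x≡y
  ... | inj₁ _   | inj₂ y≡x = sym y≡x
  ... | inj₁ x∈y | inj₁ y∈x = ⊥-elim (∈-asym x∈y y∈x)

  ∅-empty : IsEmpty (∅ M)
  ∅-empty z h = proj₂ (to (proj₂ (separation _ [] _) z) h) refl

  empty-unique : ∀ {e} → IsEmpty e → e ≡ ∅ M
  empty-unique h = extensionality _ _ λ z → mk⇔ (⊥-elim ∘ h z) (⊥-elim ∘ ∅-empty z)

  successor-unique : ∀ {s x} → IsSuccessor s x → s ≡ succ M x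
  successor-unique {s} {x} = to (characterise (insert-spec x x) s)

  ≡succᵈ : (s x : Fin n) → Def λ ρ → lookup ρ s ≡ succ M (lookup ρ x)
  ≡succᵈ s x = via (∀ᵈ 0F ∈ᵈ suc s ⇔ᵈ (0F ∈ᵈ suc x ∨ᵈ 0F ≡ᵈ suc x))
    (λ ρ → characterise (insert-spec (lookup ρ x) (lookup ρ x)) (lookup ρ s))

  ∅∈inductive : ∀ {I} → Inductive I → ∅ M ∈ I
  ∅∈inductive {I} ((e , e∈ , e-empty) , _) = subst (_∈ I) (empty-unique e-empty) e∈

  succ∈inductive : ∀ {I x} → Inductive I → x ∈ I → succ M x ∈ I
  succ∈inductive {I} {x} (_ , step) x∈ with step x x∈
  ... | s , s∈ , s-succ = subst (_∈ I) (successor-unique s-succ) s∈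

  ∅∈ω : ∅ M ∈ ω M
  ∅∈ω = from (ω-spec M _) (∅∈inductive (proj₂ infinity) , λ _ → ∅∈inductive)

  succ∈ω : ∀ {k} → k ∈ ω M → succ M k ∈ ω M
  succ∈ω h with to (ω-spec M _) h
  ... | k∈ , k∈all = from (ω-spec M _)
    (succ∈inductive (proj₂ infinity) k∈ , λ I ind → succ∈inductive ind (k∈all I ind))

  -- The members of `ω` with the property form an inductive set, and `ω` lies inside every inductive
  -- set. Definability is what lets separation form this subset.
  ω-induction : {P : Vec U (1+ n) → Set ℓ} → Def P → ∀ ρ → P (∅ M ∷ ρ) →
                (∀ k → k ∈ ω M → P (k ∷ ρ) → P (succ M k ∷ ρ)) →
                ∀ k → k ∈ ω M → P (k ∷ ρ)
  ω-induction d ρ base step k k∈ω with separate d ρ (ω M)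
  ... | I , spec = proj₂ (to (spec k) (proj₂ (to (ω-spec M k) k∈ω) I
    ( (∅ M , from (spec _) (∅∈ω , base) , ∅-empty)
    , λ x x∈ → succ M x
             , from (spec _) (Product.map succ∈ω (step x (proj₁ (to (spec x) x∈))) (to (spec x) x∈))
             , insert-spec x x)))

  ω-cases : ∀ {k} → k ∈ ω M → k ≡ ∅ M ⊎ (∃ λ j → j ∈ ω M × k ≡ succ M j)
  ω-cases {k} = ω-induction (0F ≡ᵈ 1F ∨ᵈ (∃ᵈ 0F ∈ᵈ 3F ∧ᵈ ≡succᵈ 1F 0F)) (∅ M ∷ ω M ∷ [])
    (inj₁ refl) (λ j j∈ω _ → inj₂ (j , j∈ω , refl)) k

  ω-transitive : ∀ {j k} → k ∈ ω M → j ∈ k → j ∈ ω M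
  ω-transitive {j} {k} k∈ω = ω-induction (∀ᵈ 0F ∈ᵈ 1F ⇒ᵈ 0F ∈ᵈ 2F) (ω M ∷ [])
    (λ z h → ⊥-elim (∅-empty z h))
    (λ k k∈ω ih z h → Sum.[ ih z , (λ { refl → k∈ω }) ] (to (insert-spec k k z) h))
    k k∈ω j

  -- Members of `ω` are transitive sets, by induction on the largest of the three with the other two
  -- universally quantified.
  ∈-trans : ∀ {i j k} → k ∈ ω M → i ∈ j → j ∈ k → i ∈ k
  ∈-trans {i} {j} {k} k∈ω i∈j j∈k =
    ω-induction (∀ᵈ ∀ᵈ 0F ∈ᵈ 1F ⇒ᵈ 1F ∈ᵈ 2F ⇒ᵈ 0F ∈ᵈ 2F) []
      (λ j i _ h → ⊥-elim (∅-empty j h))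
      (λ k _ ih j i i∈j h → insert-old (Sum.[ ih j i i∈j , (λ { refl → i∈j }) ]
        (to (insert-spec k k j) h)))
      k k∈ω j i i∈j j∈k

  ∅-minimum : ∀ {k} → k ∈ ω M → ∅ M ≡ k ⊎ ∅ M ∈ k
  ∅-minimum {k} = ω-induction (1F ≡ᵈ 0F ∨ᵈ 1F ∈ᵈ 0F) (∅ M ∷ [])
    (inj₁ refl)
    (λ k _ ih → inj₂ (Sum.[ (λ { refl → insert-new }) , insert-old ] ih)) k

  -- Induction on `k` shows that `succ M j` is below or equal to `k`. The successor gets its own
  -- variable `s`, because the induction formula cannot contain the term.
  succ-mono : ∀ {j k} → k ∈ ω M → j ∈ k → succ M j ∈ succ M k
  succ-mono {j} {k} k∈ω j∈k = from (insert-spec k k _)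
    (ω-induction (∀ᵈ ∀ᵈ ≡succᵈ 0F 1F ⇒ᵈ 1F ∈ᵈ 2F ⇒ᵈ 0F ∈ᵈ 2F ∨ᵈ 0F ≡ᵈ 2F) []
      (λ j _ _ h → ⊥-elim (∅-empty j h)) step k k∈ω j _ refl j∈k)
    where
    step : ∀ k → k ∈ ω M → (∀ j s → s ≡ succ M j → j ∈ k → s ∈ k ⊎ s ≡ k) →
           ∀ j s → s ≡ succ M j → j ∈ succ M k → s ∈ succ M k ⊎ s ≡ succ M k
    step k _ ih j s e h with to (insert-spec k k j) h
    ... | inj₂ refl = inj₂ e
    ... | inj₁ j∈k  = inj₁ (from (insert-spec k k s) (ih j s e j∈k))

  ω-trichotomy : ∀ {j k} → j ∈ ω M → k ∈ ω M → j ∈ k ⊎ j ≡ k ⊎ k ∈ j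
  ω-trichotomy {j} {k} j∈ω = ω-induction (1F ∈ᵈ 0F ∨ᵈ 1F ≡ᵈ 0F ∨ᵈ 0F ∈ᵈ 1F) (j ∷ [])
    (inj₂ (Sum.map₁ sym (∅-minimum j∈ω)))
    (λ k _ → λ
      { (inj₁ j∈k)         → inj₁ (insert-old j∈k)
      ; (inj₂ (inj₁ refl)) → inj₁ insert-new
      -- From `k ∈ j` follows `succ M k ∈ succ M j`, so the successor has either reached `j` or is
      -- still below it.
      ; (inj₂ (inj₂ k∈j))  → inj₂ (Sum.swap (Sum.map id sym (to (insert-spec _ _ _) (succ-mono j∈ω k∈j))))
      }) k


  ω-upper-bound : ∀ {j k} → j ∈ ω M → k ∈ ω M →
                  ∃ λ m → m ∈ ω M × (j ∈ m ⊎ j ≡ m) × (k ∈ m ⊎ k ≡ m)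
  ω-upper-bound {j} {k} j∈ω k∈ω with ω-trichotomy j∈ω k∈ω
  ... | inj₁ j∈k        = k , k∈ω , inj₁ j∈k , inj₂ refl
  ... | inj₂ (inj₁ j≡k) = k , k∈ω , inj₂ j≡k , inj₂ refl
  ... | inj₂ (inj₂ k∈j) = j , j∈ω , inj₂ refl , inj₁ k∈j

  -- Finite sets

  relationᵈ : (r a b : Fin n) → Def λ ρ → IsRelation M (lookup ρ r) (lookup ρ a) (lookup ρ b)
  relationᵈ r a b = ∀ᵈ 0F ∈ᵈ suc r ⇒ᵈ
    (∃ᵈ ∃ᵈ 1F ∈ᵈ suc (suc (suc a)) ∧ᵈ 0F ∈ᵈ suc (suc (suc b)) ∧ᵈ ≡pairᵈ 2F 1F 0F)

  -- Uniqueness states the property again where the environment holds `x` as an additional entry.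
  -- `Q` is the property with indices shifted past `x`, and the equation identifies the two
  -- versions, in place of a renaming operation on formulas.
  ∃!ᵈ : {P : Vec U (1+ n) → Set ℓ} {Q : Vec U (1+ 1+ n) → Set ℓ} → Def P → Def Q →
        (∀ ρ x y → Q (y ∷ x ∷ ρ) ≡ P (y ∷ ρ)) → Def λ ρ → ∃! _≡_ λ x → P (x ∷ ρ)
  ∃!ᵈ {P = P} {Q} p q Q≡P = via (∃ᵈ p ∧ᵈ (∀ᵈ q ⇒ᵈ 1F ≡ᵈ 0F)) λ ρ → mk⇔
    (λ (x , px , u) → x , px , λ {y} py → u y (subst id (sym (Q≡P ρ x y)) py))
    (λ (x , px , u) → x , px , λ y qy → u (subst id (Q≡P ρ x y) qy))

  functionᵈ : (f a b : Fin n) → Def λ ρ → IsFunction M (lookup ρ f) (lookup ρ a) (lookup ρ b)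
  functionᵈ f a b = relationᵈ f a b ∧ᵈ
    (∀ᵈ 0F ∈ᵈ suc a ⇒ᵈ
      ∃!ᵈ (pair∈ᵈ 1F 0F (suc (suc f))) (pair∈ᵈ 2F 0F (suc (suc (suc f)))) (λ _ _ _ → refl))

  bijectionᵈ : (f a b : Fin n) → Def λ ρ → IsBijection M (lookup ρ f) (lookup ρ a) (lookup ρ b)
  bijectionᵈ f a b = functionᵈ f a b ∧ᵈ
    (∀ᵈ 0F ∈ᵈ suc b ⇒ᵈ
      ∃!ᵈ (pair∈ᵈ 0F 1F (suc (suc f))) (pair∈ᵈ 0F 2F (suc (suc (suc f)))) (λ _ _ _ → refl))

  -- The set `ω` is not a term of the language, so it is supplied as a parameter at index `w`.
  finiteᵈ : (x w : Fin n) → Def λ ρ →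
            ∃ λ m → m ∈ lookup ρ w × (∃ λ f → IsBijection M f m (lookup ρ x))
  finiteᵈ x w = ∃ᵈ 0F ∈ᵈ suc w ∧ᵈ (∃ᵈ bijectionᵈ 0F 1F (suc (suc x)))

  empty-finite : ∀ {a} → IsEmpty a → Finite M a
  empty-finite a-empty = ∅ M , ∅∈ω , ∅ M ,
    ((λ p h → ⊥-elim (∅-empty p h)) , (λ x h → ⊥-elim (∅-empty x h))) ,
    (λ y h → ⊥-elim (a-empty y h))

  insert-finite : ∀ {a y} → Finite M a → ¬ y ∈ a → Finite M (insert y a)
  insert-finite (n , n∈ω , f , bij) y∉a = succ M n , succ∈ω n∈ω , _ , insert-bijection bij ∈-irrefl y∉a

  opaque
    -- Finitely many individual bounds have a common one. Induction along the enumeration `f`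
    -- maintains a bound for the members with index in `k` and raises it for the member at `k`. The
    -- property is a set `q` of pairs so that it can be a parameter of the induction formula.
    finite-bound : ∀ {a q} → Finite M a →
      (∀ y → y ∈ a → ∃ λ m → m ∈ ω M × ⟪ y , m ⟫ ∈ q) →
      (∀ y m m′ → m′ ∈ ω M → m ∈ m′ → ⟪ y , m ⟫ ∈ q → ⟪ y , m′ ⟫ ∈ q) →
      ∃ λ m → m ∈ ω M × (∀ y → y ∈ a → ⟪ y , m ⟫ ∈ q)
    finite-bound {a} {q} (n , n∈ω , f , fun , sur) bound mono
      with ω-induction (∃ᵈ 0F ∈ᵈ 2F ∧ᵈ (∀ᵈ ∀ᵈ 1F ∈ᵈ 3F ⇒ᵈ pair∈ᵈ 1F 0F 5F ⇒ᵈ pair∈ᵈ 0F 2F 6F))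
                       (ω M ∷ f ∷ q ∷ [])
                       (∅ M , ∅∈ω , λ j _ h → ⊥-elim (∅-empty j h)) step n n∈ω
      where
      Bound : U → Set ℓ
      Bound k = ∃ λ m → m ∈ ω M × (∀ j y → j ∈ k → ⟪ j , y ⟫ ∈ f → ⟪ y , m ⟫ ∈ q)
      weaken : ∀ {y m m′} → m′ ∈ ω M → m ∈ m′ ⊎ m ≡ m′ → ⟪ y , m ⟫ ∈ q → ⟪ y , m′ ⟫ ∈ q
      weaken m′∈ω (inj₁ m∈m′) = mono _ _ _ m′∈ω m∈m′
      weaken _    (inj₂ refl) = id
      step : ∀ k → k ∈ ω M → Bound k → Bound (succ M k)
      -- The induction runs through all of `ω`, so `k` may lie outside the domain of `f`; the old
      -- bound then still works.
      step k _ (m , m∈ω , ih) with em (∃ᵈ pair∈ᵈ 1F 0F 2F) (k ∷ f ∷ [])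
      ... | inj₂ ∄ = m , m∈ω , λ j y j∈ jy →
        Sum.[ (λ j∈k → ih j y j∈k jy) , (λ { refl → ⊥-elim (∄ (y , jy)) }) ]
          (to (insert-spec k k j) j∈)
      ... | inj₁ (y , ky) with bound y (proj₂ (relation-∈ (proj₁ fun) ky))
      ...   | m₁ , m₁∈ω , ym₁ with ω-upper-bound m∈ω m₁∈ω
      ...     | m₂ , m₂∈ω , m≤m₂ , m₁≤m₂ = m₂ , m₂∈ω , bounded
        where
        bounded : ∀ j z → j ∈ succ M k → ⟪ j , z ⟫ ∈ f → ⟪ z , m₂ ⟫ ∈ q
        bounded j z j∈ jz =
          Sum.[ (λ j∈k → weaken m₂∈ω m≤m₂ (ih j z j∈k jz))
              , (λ { refl → subst (λ v → ⟪ v , m₂ ⟫ ∈ q) (function-unique fun ky jz)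
                                  (weaken m₂∈ω m₁≤m₂ ym₁) }) ]
            (to (insert-spec k k j) j∈)
    ... | m , m∈ω , h = m , m∈ω , λ y y∈a → let (j , jy , _) = sur y y∈a in
      h j y (proj₁ (relation-∈ (proj₁ fun) jy)) jy

  -- Colorings

  upair∈[]² : ∀ {x y v} → x ∈ v → y ∈ v → ¬ x ≡ y → ⟅ x , y ⟆ ∈ [_]² M v
  upair∈[]² {x} {y} x∈ y∈ x≢y = from ([]²-spec M _ _)
    (from (powerSet-spec _ _) (upair-⊆ x∈ y∈) , x , y , x≢y , upair-spec x y)

  ∈[]²-upair : ∀ {e v} → e ∈ [_]² M v →
               ∃ λ x → ∃ λ y → x ∈ v × y ∈ v × ¬ x ≡ y × e ≡ ⟅ x , y ⟆
  ∈[]²-upair {e} h with to ([]²-spec M _ e) h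
  ... | e∈𝒫 , x , y , x≢y , spec =
    x , y , e⊆ x (from (spec x) (inj₁ refl)) , e⊆ y (from (spec y) (inj₂ refl)) , x≢y ,
    to (characterise (upair-spec x y) e) spec
    where e⊆ = to (powerSet-spec _ e) e∈𝒫

  𝟎≢𝟏 : ¬ 𝟎 M ≡ 𝟏 M
  𝟎≢𝟏 e = ∅-empty _ (subst (∅ M ∈_) (sym e) insert-new)

  maximal-resp : {P Q : U → Set ℓ} → (∀ Y → P Y ⇔ Q Y) → ∀ {Y} → Maximal P Y → Maximal Q Y
  maximal-resp P⇔Q (pY , max) = to (P⇔Q _) pY , λ Z qZ → max Z (from (P⇔Q Z) qZ)

  open Graph

  -- Reduces both passages between colorings and graphs to one construction: making the nonedges
  -- exactly the pairs of color `𝟎`.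
  mono⇔independent : ∀ G f → (∀ e → e ∈ [_]² M (vertices G) → ⟪ e , 𝟎 M ⟫ ∈ f ⇔ (¬ e ∈ edges G)) →
                     ∀ Y → ZeroMonochromatic M G f Y ⇔ Independent M G Y
  mono⇔independent G f f≡0 Y = mk⇔
    (λ (Y⊆ , h) → Y⊆ , λ x y x∈ y∈ x≢y →
      to (f≡0 _ (upair∈[]² (Y⊆ x x∈) (Y⊆ y y∈) x≢y)) (h _ (upair∈[]² x∈ y∈ x≢y)))
    (λ (Y⊆ , h) → Y⊆ , λ e e∈ → fromIndependent Y⊆ h e (∈[]²-upair e∈))
    where
    fromIndependent : Y ⊆ vertices G →
      (∀ x y → x ∈ Y → y ∈ Y → ¬ x ≡ y → ¬ Adjacent M G x y) →
      ∀ e → (∃ λ x → ∃ λ y → x ∈ Y × y ∈ Y × ¬ x ≡ y × e ≡ ⟅ x , y ⟆) → ⟪ e , 𝟎 M ⟫ ∈ f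
    fromIndependent Y⊆ h _ (x , y , x∈ , y∈ , x≢y , refl) =
      from (f≡0 _ (upair∈[]² (Y⊆ x x∈) (Y⊆ y y∈) x≢y)) (h x y x∈ y∈ x≢y)

  -- The pairs of color `𝟏` become the edges. The vertex set is unchanged, so infinitude carries
  -- over.
  independent⇒mono : MaximalIndependent M → MaximalZeroMonochromatic M
  independent⇒mono mi G inf f fun fin
    with separate (pair∈ᵈ 0F 1F 2F) (𝟏 M ∷ f ∷ []) ([_]² M (vertices G))
  ... | E , E-spec =
    Product.map₂ (maximal-resp (⇔.sym ∘ equiv))
      (mi H inf λ I ind → fin I (from (equiv I) ind))
    where
    H : Graph M
    H = record { vertices = vertices G ; edges = E ; edges⊆ = λ e e∈ → proj₁ (to (E-spec e) e∈) }
    colored-0 : ∀ e → e ∈ [_]² M (vertices G) → ⟪ e , 𝟎 M ⟫ ∈ f ⇔ (¬ e ∈ E)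
    colored-0 e e∈ = mk⇔ (λ h e∈E → 𝟎≢𝟏 (function-unique fun h (proj₂ (to (E-spec e) e∈E)))) bwd
      where
      bwd : ¬ e ∈ E → ⟪ e , 𝟎 M ⟫ ∈ f
      bwd e∉E with function-value fun e∈
      ... | v , ev with to (upair-spec _ _ v) (proj₂ (relation-∈ (proj₁ fun) ev))
      ... | inj₁ refl = ev
      ... | inj₂ refl = ⊥-elim (e∉E (from (E-spec e) (e∈ , ev)))
    equiv : ∀ Y → ZeroMonochromatic M G f Y ⇔ Independent M H Y
    equiv = mono⇔independent H f colored-0

  -- The coloring is the characteristic function of the edge set, total by excluded middle for
  -- membership in it.
  mono⇒independent : MaximalZeroMonochromatic M → MaximalIndependent M
  mono⇒independent mz G inf fin
    with separateRelation (1F ∈ᵈ 5F ∧ᵈ 0F ≡ᵈ 4F ∨ᵈ ¬ᵈ (1F ∈ᵈ 5F) ∧ᵈ 0F ≡ᵈ 3F)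
           (𝟎 M ∷ 𝟏 M ∷ edges G ∷ []) ([_]² M (vertices G)) ⟅ 𝟎 M , 𝟏 M ⟆
  ... | f , f-rel , f-spec =
    Product.map₂ (maximal-resp equiv)
      (mz G inf f (f-rel , total) λ Y mono → fin Y (to (equiv Y) mono))
    where
    total : ∀ e → e ∈ [_]² M (vertices G) → ∃! _≡_ λ i → ⟪ e , i ⟫ ∈ f
    total e e∈ with em (0F ∈ᵈ 1F) (e ∷ edges G ∷ [])
    ... | inj₁ e∈E = 𝟏 M , from (f-spec _ _) (e∈ , upair-right _ _ , inj₁ (e∈E , refl)) ,
      λ h → Sum.[ (λ (_ , i≡1) → sym i≡1) , (λ (e∉E , _) → ⊥-elim (e∉E e∈E)) ]
              (proj₂ (proj₂ (to (f-spec _ _) h)))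
    ... | inj₂ e∉E = 𝟎 M , from (f-spec _ _) (e∈ , upair-left _ _ , inj₂ (e∉E , refl)) ,
      λ h → Sum.[ (λ (e∈E , _) → ⊥-elim (e∉E e∈E)) , (λ (_ , i≡0) → sym i≡0) ]
              (proj₂ (proj₂ (to (f-spec _ _) h)))
    colored-0 : ∀ e → e ∈ [_]² M (vertices G) → ⟪ e , 𝟎 M ⟫ ∈ f ⇔ (¬ e ∈ edges G)
    colored-0 e e∈ = mk⇔
      (λ h → Sum.[ (λ (_ , 0≡1) → ⊥-elim (𝟎≢𝟏 0≡1)) , proj₁ ] (proj₂ (proj₂ (to (f-spec _ _) h))))
      (λ e∉E → from (f-spec _ _) (e∈ , upair-left _ _ , inj₂ (e∉E , refl)))
    equiv : ∀ Y → ZeroMonochromatic M G f Y ⇔ Independent M G Y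
    equiv = mono⇔independent G f colored-0

  -- Increasing chains from dependent choice

  module _ {s S} (s-fun : IsFunction M s (ω M) S)
           (s-step : ∀ n x y → n ∈ ω M → ⟪ n , x ⟫ ∈ s → ⟪ succ M n , y ⟫ ∈ s → x ⊊ y) where

    chain-monotone : ∀ {j k x y} → k ∈ ω M → j ∈ k → ⟪ j , x ⟫ ∈ s → ⟪ k , y ⟫ ∈ s → x ⊆ y
    chain-monotone {j} {k} {x} {y} k∈ω j∈k jx ky =
      ω-induction (∀ᵈ ∀ᵈ ∀ᵈ 2F ∈ᵈ 3F ⇒ᵈ pair∈ᵈ 2F 1F 4F ⇒ᵈ pair∈ᵈ 3F 0F 4F ⇒ᵈ 1F ⊆ᵈ 0F)
        (s ∷ []) (λ j _ _ h → ⊥-elim (∅-empty j h)) step k k∈ω j x y j∈k jx ky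
      where
      step : ∀ k → k ∈ ω M →
             (∀ j x y → j ∈ k → ⟪ j , x ⟫ ∈ s → ⟪ k , y ⟫ ∈ s → x ⊆ y) →
             ∀ j x y → j ∈ succ M k → ⟪ j , x ⟫ ∈ s → ⟪ succ M k , y ⟫ ∈ s → x ⊆ y
      step k k∈ω ih j x y j∈ jx ky⁺ with to (insert-spec k k j) j∈
      ... | inj₂ refl = proj₁ (s-step _ _ _ k∈ω jx ky⁺)
      ... | inj₁ j∈k with function-value s-fun k∈ω
      ...   | z , kz = λ v v∈x → proj₁ (s-step _ _ _ k∈ω kz ky⁺) v (ih j x z j∈k jx kz v v∈x)

    chain-total : ∀ {j k x y} → ⟪ j , x ⟫ ∈ s → ⟪ k , y ⟫ ∈ s → x ⊆ y ⊎ y ⊆ x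
    chain-total jx ky
      with proj₁ (relation-∈ (proj₁ s-fun) jx) | proj₁ (relation-∈ (proj₁ s-fun) ky)
    ... | j∈ω | k∈ω with ω-trichotomy j∈ω k∈ω
    ... | inj₁ j∈k = inj₁ (chain-monotone k∈ω j∈k jx ky)
    ... | inj₂ (inj₂ k∈j) = inj₂ (chain-monotone j∈ω k∈j ky jx)
    ... | inj₂ (inj₁ refl) with function-unique s-fun jx ky
    ...   | refl = inj₁ λ _ → id

    chain-union-infinite : ∀ {Y} → (∀ v → v ∈ Y ⇔ (∃ λ k → ∃ λ x → ⟪ k , x ⟫ ∈ s × v ∈ x)) →
                           ¬ Finite M Y
    chain-union-infinite {Y} Y-spec Y-fin
      -- The relation `q` holds between `v` and the stages whose set contains `v`; it is upward
      -- closed because the chain increases. A common bound `m` is a stage that contains all of `Y`,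
      -- including the next stage.
      with separateRelation (∃ᵈ pair∈ᵈ 1F 0F 4F ∧ᵈ 2F ∈ᵈ 0F) (s ∷ []) Y (ω M)
    ... | q , _ , q-spec with finite-bound {q = q} Y-fin bound mono
      where
      bound : ∀ v → v ∈ Y → ∃ λ m → m ∈ ω M × ⟪ v , m ⟫ ∈ q
      bound v v∈Y with to (Y-spec v) v∈Y
      ... | m , x , mx , v∈x with proj₁ (relation-∈ (proj₁ s-fun) mx)
      ...   | m∈ω = m , m∈ω , from (q-spec v m) (v∈Y , m∈ω , x , mx , v∈x)
      mono : ∀ v m m′ → m′ ∈ ω M → m ∈ m′ → ⟪ v , m ⟫ ∈ q → ⟪ v , m′ ⟫ ∈ q
      mono v m m′ m′∈ω m∈m′ h with to (q-spec v m) h | function-value s-fun m′∈ω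
      ... | v∈Y , _ , x , mx , v∈x | y , m′y =
        from (q-spec v m′) (v∈Y , m′∈ω , y , m′y , chain-monotone m′∈ω m∈m′ mx m′y v v∈x)
    ... | m , m∈ω , h with function-value s-fun m∈ω | function-value s-fun (succ∈ω m∈ω)
    ... | x , mx | y , m⁺y with s-step m x y m∈ω mx m⁺y
    ... | x⊆y , x≢y = x≢y (⊆-antisym x⊆y y⊆x)
      where
      y⊆x : y ⊆ x
      y⊆x v v∈y with to (q-spec v m) (h v (from (Y-spec v) (_ , y , m⁺y , v∈y)))
      ... | _ , _ , x′ , mx′ , v∈x′ with function-unique s-fun mx mx′
      ... | refl = v∈x′

  twoElementᵈ : (e : Fin n) → Def λ ρ → TwoElement (lookup ρ e)
  twoElementᵈ e =
    ∃ᵈ ∃ᵈ ¬ᵈ (1F ≡ᵈ 0F) ∧ᵈ (∀ᵈ 0F ∈ᵈ suc (suc (suc e)) ⇔ᵈ (0F ≡ᵈ 2F ∨ᵈ 0F ≡ᵈ 1F))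

  []²ᵈ : (e v : Fin n) → Def λ ρ → lookup ρ e ∈ [_]² M (lookup ρ v)
  []²ᵈ e v = via (e ⊆ᵈ v ∧ᵈ twoElementᵈ e) λ ρ → ⇔.trans
    (mk⇔ (Product.map₁ (from (powerSet-spec _ _))) (Product.map₁ (to (powerSet-spec _ _))))
    (⇔.sym ([]²-spec M _ _))

  dependentChoice⇒mono : DC M → MaximalZeroMonochromatic M
  dependentChoice⇒mono dc G _ f _ fin
    -- `S` is the set of all 0-monochromatic sets.
    with separate (∀ᵈ []²ᵈ 0F 1F ⇒ᵈ pair∈ᵈ 0F 3F 2F) (f ∷ 𝟎 M ∷ []) (𝒫 M (vertices G))
  ... | S , S-spec = Sum.[ maximal , ⊥-elim ∘ no-maximal-absurd ]
      (em (∃ᵈ 0F ∈ᵈ 1F ∧ᵈ (∀ᵈ 0F ∈ᵈ 2F ⇒ᵈ ¬ᵈ (1F ⊊ᵈ 0F))) (S ∷ []))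
    where
    Mono = ZeroMonochromatic M G f
    mono⇔∈S : ∀ Y → Y ∈ S ⇔ Mono Y
    mono⇔∈S Y = ⇔.trans (S-spec Y)
      (mk⇔ (Product.map₁ (to (powerSet-spec _ _))) (Product.map₁ (from (powerSet-spec _ _))))

    maximal : (∃ λ Y → Y ∈ S × (∀ Z → Z ∈ S → ¬ Y ⊊ Z)) → ∃ λ Y → Maximal Mono Y
    maximal (Y , Y∈S , max) =
      Y , to (mono⇔∈S Y) Y∈S , λ Z Z-mono → max Z (from (mono⇔∈S Z) Z-mono)

    empty-mono : Mono (∅ M)
    empty-mono = (λ v h → ⊥-elim (∅-empty v h)) , λ e e∈ →
      ⊥-elim (∅-empty _ (proj₁ (proj₂ (proj₂ (∈[]²-upair e∈)))))

    union-mono : ∀ {s} → IsFunction M s (ω M) S →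
                 (∀ {j k x y} → ⟪ j , x ⟫ ∈ s → ⟪ k , y ⟫ ∈ s → x ⊆ y ⊎ y ⊆ x) →
                 ∀ {Y} → (∀ v → v ∈ Y ⇔ (∃ λ k → ∃ λ x → ⟪ k , x ⟫ ∈ s × v ∈ x)) → Mono Y
    union-mono {s} s-fun total {Y} Y-spec = Y⊆ , colored
      where
      member-mono : ∀ {k x} → ⟪ k , x ⟫ ∈ s → Mono x
      member-mono kx = to (mono⇔∈S _) (proj₂ (relation-∈ (proj₁ s-fun) kx))
      Y⊆ : Y ⊆ vertices G
      Y⊆ v v∈Y with to (Y-spec v) v∈Y
      ... | _ , _ , kx , v∈x = proj₁ (member-mono kx) v v∈x
      colored : ∀ e → e ∈ [_]² M Y → ⟪ e , 𝟎 M ⟫ ∈ f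
      colored e e∈ with ∈[]²-upair e∈
      ... | a , b , a∈Y , b∈Y , a≢b , refl with to (Y-spec a) a∈Y | to (Y-spec b) b∈Y
      -- Of two comparable stages the larger contains both endpoints, so the pair already has color
      -- `𝟎` there.
      ... | _ , x , jx , a∈x | _ , y , ky , b∈y with total jx ky
      ... | inj₁ x⊆y = proj₂ (member-mono ky) _ (upair∈[]² (x⊆y a a∈x) b∈y a≢b)
      ... | inj₂ y⊆x = proj₂ (member-mono jx) _ (upair∈[]² a∈x (y⊆x b b∈y) a≢b)

    no-maximal-absurd : ¬ ¬ (∃ λ Y → Y ∈ S × (∀ Z → Z ∈ S → ¬ Y ⊊ Z))
    -- Dependent choice is applied to strict inclusion on `S`: the empty set shows that `S` is
    -- inhabited, and the lack of a maximal member makes the relation total.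
    no-maximal-absurd ∄ with separateRelation (1F ⊊ᵈ 0F) [] S S
    ... | R , R-rel , R-spec with dc S R (∅ M , from (mono⇔∈S _) empty-mono) R-rel larger
      where
      larger : ∀ Y → Y ∈ S → ∃ λ Z → Z ∈ S × ⟪ Y , Z ⟫ ∈ R
      larger Y Y∈S with em (∃ᵈ 0F ∈ᵈ 2F ∧ᵈ 1F ⊊ᵈ 0F) (Y ∷ S ∷ [])
      ... | inj₁ (Z , Z∈S , Y⊊Z) = Z , Z∈S , from (R-spec Y Z) (Y∈S , Z∈S , Y⊊Z)
      ... | inj₂ ∄larger = ⊥-elim (∄ (Y , Y∈S , λ Z Z∈S Y⊊Z → ∄larger (Z , Z∈S , Y⊊Z)))
    ... | s , s-fun , s-step
      with separate (∃ᵈ ∃ᵈ pair∈ᵈ 1F 0F 3F ∧ᵈ 2F ∈ᵈ 0F) (s ∷ []) (vertices G)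
    ... | Y , Y-spec′ =
      chain-union-infinite s-fun strict Y-spec
        (fin Y (union-mono s-fun (chain-total s-fun strict) Y-spec))
      where
      strict : ∀ n x y → n ∈ ω M → ⟪ n , x ⟫ ∈ s → ⟪ succ M n , y ⟫ ∈ s → x ⊊ y
      strict n x y n∈ω nx n⁺y = proj₂ (proj₂ (to (R-spec x y) (s-step n x y n∈ω nx n⁺y)))
      Y-spec : ∀ v → v ∈ Y ⇔ (∃ λ k → ∃ λ x → ⟪ k , x ⟫ ∈ s × v ∈ x)
      Y-spec v = ⇔.trans (Y-spec′ v) (mk⇔ proj₂ λ { h@(_ , x , kx , v∈x) →
        proj₁ (to (mono⇔∈S x) (proj₂ (relation-∈ (proj₁ s-fun) kx))) v v∈x , h })

  -- The graph of finite paths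

  -- In particular the length of a path is determined by the path.
  function-domain-unique : ∀ {f a b c d} → IsFunction M f a c → IsFunction M f b d → a ≡ b
  function-domain-unique {f} fun fun′ =
    extensionality _ _ λ k → mk⇔ (domain-⊆ fun fun′ k) (domain-⊆ fun′ fun k)
    where
    domain-⊆ : ∀ {a b c d} → IsFunction M f a c → IsFunction M f b d → a ⊆ b
    domain-⊆ fun fun′ k k∈ = proj₁ (relation-∈ (proj₁ fun′) (proj₂ (function-value fun k∈)))

  -- k′ names succ k because the only terms of a formula are variables.
  IsPath : U → U → U → U → Set ℓ
  IsPath S R t n = IsFunction M t n S
    × (∀ k k′ x y → k′ ≡ succ M k → ⟪ k , x ⟫ ∈ t → ⟪ k′ , y ⟫ ∈ t → ⟪ x , y ⟫ ∈ R)

  pathᵈ : (S R t m : Fin n) →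
          Def λ ρ → IsPath (lookup ρ S) (lookup ρ R) (lookup ρ t) (lookup ρ m)
  pathᵈ S R t m = functionᵈ t m S ∧ᵈ
    (∀ᵈ ∀ᵈ ∀ᵈ ∀ᵈ ≡succᵈ 2F 3F ⇒ᵈ pair∈ᵈ 3F 1F (4+ t) ⇒ᵈ pair∈ᵈ 2F 0F (4+ t) ⇒ᵈ pair∈ᵈ 1F 0F (4+ R))
    where
    4+_ : ∀ {n} → Fin n → Fin (1+ 1+ 1+ 1+ n)
    4+ i = suc (suc (suc (suc i)))

  module _ (S R : U) where

    Path : U → U → Set ℓ
    Path = IsPath S R

    empty-path : Path (∅ M) (∅ M)
    empty-path = ((λ p h → ⊥-elim (∅-empty p h)) , (λ k h → ⊥-elim (∅-empty k h))) ,
                 (λ _ _ _ _ _ h → ⊥-elim (∅-empty _ h))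

    path-⊆-agree : ∀ {t u a b k z} → Path t a → Path u b → t ⊆ u → k ∈ a →
                   ⟪ k , z ⟫ ∈ u → ⟪ k , z ⟫ ∈ t
    path-⊆-agree {k = k} (t-fun , _) (u-fun , _) t⊆u k∈a kz with function-value t-fun k∈a
    ... | y , ky with function-unique u-fun (t⊆u _ ky) kz
    ... | refl = ky

    -- At each index of `u` the path `t` already has a value, and the inclusion of `t` in `u` forces
    -- the two values to agree.
    path-⊆ : ∀ {t u a b} → Path t a → Path u b → b ⊆ a → t ⊆ u → u ⊆ t
    path-⊆ t-path u-path b⊆a t⊆u p p∈u with proj₁ (proj₁ u-path) p p∈u
    ... | k , z , k∈b , _ , refl = path-⊆-agree t-path u-path t⊆u (b⊆a k k∈b) p∈u

    opaque
      -- Paths of finite length are subsets of `ω × S`, so they form a set.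
      vertex-set : ∃ λ V → ∀ t → t ∈ V ⇔ (∃ λ n → n ∈ ω M × Path t n)
      vertex-set with separate (∃ᵈ 0F ∈ᵈ 2F ∧ᵈ pathᵈ 3F 4F 1F 0F) (ω M ∷ S ∷ R ∷ [])
                               (𝒫 M (proj₁ (product (ω M) S)))
      ... | V , V-spec = V , λ t → ⇔.trans (V-spec t) (mk⇔ proj₂ λ h → bounded h , h)
        where
        bounded : ∀ {t} → (∃ λ n → n ∈ ω M × Path t n) → t ∈ 𝒫 M (proj₁ (product (ω M) S))
        bounded {t} (n , n∈ω , (rel , _) , _) = from (powerSet-spec _ _) sub
          where
          sub : t ⊆ proj₁ (product (ω M) S)
          sub p p∈t with rel p p∈t
          ... | k , x , k∈n , x∈S , e =
            from (proj₂ (product (ω M) S) p) (k , x , ω-transitive n∈ω k∈n , x∈S , e)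

    V : U
    V = proj₁ vertex-set

    V-spec : ∀ t → t ∈ V ⇔ (∃ λ n → n ∈ ω M × Path t n)
    V-spec = proj₂ vertex-set

    opaque
      -- Incomparable members of a two-element set are distinct and hence are its two elements, so
      -- the formula need not present `e` as a pair.
      edge-set : ∃ λ E → ∀ e → e ∈ E ⇔ (e ∈ [_]² M V ×
                   (∃ λ t → ∃ λ u → t ∈ e × u ∈ e × (¬ t ⊆ u) × (¬ u ⊆ t)))
      edge-set = separate (∃ᵈ ∃ᵈ 1F ∈ᵈ 2F ∧ᵈ 0F ∈ᵈ 2F ∧ᵈ ¬ᵈ (1F ⊆ᵈ 0F) ∧ᵈ ¬ᵈ (0F ⊆ᵈ 1F)) [] ([_]² M V)

    pathGraph : Graph M
    pathGraph = record { vertices = V ; edges = proj₁ edge-set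
                       ; edges⊆ = λ e e∈ → proj₁ (to (proj₂ edge-set e) e∈) }

    -- Bounded and unbounded chains of paths

    Chain : U → Set ℓ
    Chain I = I ⊆ V × (∀ t u → t ∈ I → u ∈ I → t ⊆ u ⊎ u ⊆ t)

    Unbounded : U → Set ℓ
    Unbounded I = ∀ n → n ∈ ω M → ∃ λ t → t ∈ I × (∃ λ y → ⟪ n , y ⟫ ∈ t)

    -- The bound is a finite path that need not belong to `I`; thus the empty chain is bounded by
    -- the empty path.
    Bounded : U → Set ℓ
    Bounded I = ∃ λ t → t ∈ V × (∀ u → u ∈ I → u ⊆ t)

    independent⇔chain : ∀ I → Independent M pathGraph I ⇔ Chain I
    independent⇔chain I = mk⇔
      (λ (I⊆V , ind) → I⊆V , λ t u t∈I u∈I → total I⊆V ind t∈I u∈I)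
      (λ (I⊆V , total) → I⊆V , λ t u t∈I u∈I _ → notAdjacent total t∈I u∈I)
      where
      total : I ⊆ V → (∀ t u → t ∈ I → u ∈ I → ¬ t ≡ u → ¬ Adjacent M pathGraph t u) →
              ∀ {t u} → t ∈ I → u ∈ I → t ⊆ u ⊎ u ⊆ t
      total I⊆V ind {t} {u} t∈I u∈I
        with em (0F ⊆ᵈ 1F) (t ∷ u ∷ []) | em (0F ⊆ᵈ 1F) (u ∷ t ∷ [])
      ... | inj₁ t⊆u | _        = inj₁ t⊆u
      ... | inj₂ _   | inj₁ u⊆t = inj₂ u⊆t
      ... | inj₂ t⊈u | inj₂ u⊈t = ⊥-elim (ind t u t∈I u∈I t≢u (from (proj₂ edge-set _)
              (upair∈[]² (I⊆V t t∈I) (I⊆V u u∈I) t≢u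
              , t , u , upair-left t u , upair-right t u , t⊈u , u⊈t)))
        where
        t≢u : ¬ t ≡ u
        t≢u refl = t⊈u λ _ → id
      notAdjacent : (∀ t u → t ∈ I → u ∈ I → t ⊆ u ⊎ u ⊆ t) →
                    ∀ {t u} → t ∈ I → u ∈ I → ¬ Adjacent M pathGraph t u
      notAdjacent total t∈I u∈I adj with to (proj₂ edge-set _) adj
      ... | _ , t′ , u′ , t′∈ , u′∈ , t′⊈u′ , u′⊈t′ =
        Sum.[ t′⊈u′ , u′⊈t′ ] (total t′ u′ (upair-⊆ t∈I u∈I t′ t′∈) (upair-⊆ t∈I u∈I u′ u′∈))

    -- If no member is defined at `succ M n`, then `t`, being defined at `n`, is the largest member:
    -- a member extending `t` has no index beyond `n`, so its domain lies in that of `t` and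
    -- `path-⊆` applies.
    path-bound-step : ∀ {I n} → Chain I → n ∈ ω M →
      (∃ λ t → t ∈ I × (∃ λ y → ⟪ n , y ⟫ ∈ t)) →
      (∃ λ t → t ∈ I × (∃ λ y → ⟪ succ M n , y ⟫ ∈ t)) ⊎ Bounded I
    path-bound-step {I} {n} (I⊆V , total) n∈ω (t , t∈I , y , ny)
      with em (∃ᵈ 0F ∈ᵈ 2F ∧ᵈ (∃ᵈ pair∈ᵈ 2F 0F 1F)) (succ M n ∷ I ∷ [])
    ... | inj₁ longer = inj₁ longer
    ... | inj₂ ∄ with to (V-spec t) (I⊆V t t∈I)
    ...   | a , a∈ω , t-path = inj₂ (t , I⊆V t t∈I , λ u u∈I → Sum.[ below u u∈I , id ] (total t u t∈I u∈I))
      where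
      n∈a : n ∈ a
      n∈a = proj₁ (relation-∈ (proj₁ (proj₁ t-path)) ny)
      below : ∀ u → u ∈ I → t ⊆ u → u ⊆ t
      below u u∈I t⊆u with to (V-spec u) (I⊆V u u∈I)
      ... | b , b∈ω , u-path = path-⊆ t-path u-path b⊆a t⊆u
        where
        succ∉b : ¬ succ M n ∈ b
        succ∉b h = ∄ (u , u∈I , function-value (proj₁ u-path) h)
        b⊆a : b ⊆ a
        b⊆a k k∈b with ω-trichotomy (ω-transitive b∈ω k∈b) (succ∈ω n∈ω)
        ... | inj₂ (inj₁ refl) = ⊥-elim (succ∉b k∈b)
        ... | inj₂ (inj₂ h)    = ⊥-elim (succ∉b (∈-trans b∈ω h k∈b))
        ... | inj₁ k∈succ with to (insert-spec n n k) k∈succ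
        ...   | inj₁ k∈n  = ∈-trans a∈ω k∈n n∈a
        ...   | inj₂ refl = n∈a

    -- When there is no bound, induction reaches every index, since `path-bound-step` can only fail
    -- to advance by producing a bound.
    unbounded-or-bounded : ∀ {I} → Chain I → Unbounded I ⊎ Bounded I
    unbounded-or-bounded {I} chain
      with em (∃ᵈ 0F ∈ᵈ 2F ∧ᵈ (∀ᵈ 0F ∈ᵈ 2F ⇒ᵈ 0F ⊆ᵈ 1F)) (I ∷ V ∷ [])
    ... | inj₁ bounded  = inj₂ bounded
    ... | inj₂ ¬bounded = inj₁ (ω-induction (∃ᵈ 0F ∈ᵈ 2F ∧ᵈ (∃ᵈ pair∈ᵈ 2F 0F 1F)) (I ∷ []) base
        λ n n∈ω ih → Sum.[ id , ⊥-elim ∘ ¬bounded ] (path-bound-step chain n∈ω ih))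
      where
      base : ∃ λ t → t ∈ I × (∃ λ y → ⟪ ∅ M , y ⟫ ∈ t)
      base with em (∃ᵈ 0F ∈ᵈ 2F ∧ᵈ (∃ᵈ pair∈ᵈ 2F 0F 1F)) (∅ M ∷ I ∷ [])
      ... | inj₁ h = h
      -- If no member is defined at `∅`, all members are empty and the empty path bounds them.
      ... | inj₂ ∄ = ⊥-elim (¬bounded (∅ M , from (V-spec _) (∅ M , ∅∈ω , empty-path) , all-empty))
        where
        all-empty : ∀ u → u ∈ I → u ⊆ ∅ M
        all-empty u u∈I p p∈u with to (V-spec u) (proj₁ chain u u∈I)
        ... | b , b∈ω , (rel , tot) , _ with rel p p∈u
        ... | k , _ , k∈b , _ with ∅-minimum b∈ω
        ... | inj₁ refl = ⊥-elim (∅-empty k k∈b)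
        ... | inj₂ ∅∈b  = ⊥-elim (∄ (u , u∈I , function-value (rel , tot) ∅∈b))

    opaque
      -- The members of a chain shorter than n: there is at most one of each length.
      shorter-finite : ∀ {I} → Chain I → ∀ n → n ∈ ω M →
        ∃ λ A → (∀ u → u ∈ A ⇔ (u ∈ I × (∃ λ k → k ∈ n × Path u k))) × Finite M A
      shorter-finite {I} (I⊆V , total) =
        ω-induction
          (∃ᵈ (∀ᵈ 0F ∈ᵈ 1F ⇔ᵈ 0F ∈ᵈ 3F ∧ᵈ (∃ᵈ 0F ∈ᵈ 3F ∧ᵈ pathᵈ 5F 6F 1F 0F)) ∧ᵈ finiteᵈ 0F 5F)
          (I ∷ S ∷ R ∷ ω M ∷ [])
          (∅ M , (λ u → mk⇔ (⊥-elim ∘ ∅-empty u) (λ (_ , k , k∈ , _) → ⊥-elim (∅-empty k k∈)))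
               , empty-finite ∅-empty)
          step
        where
        Short : U → U → Set ℓ
        Short n u = u ∈ I × (∃ λ k → k ∈ n × Path u k)
        step : ∀ n → n ∈ ω M → (∃ λ A → (∀ u → u ∈ A ⇔ Short n u) × Finite M A) →
               ∃ λ A → (∀ u → u ∈ A ⇔ Short (succ M n) u) × Finite M A
        step n n∈ω (A , A-spec , A-fin)
          with em (∃ᵈ 0F ∈ᵈ 2F ∧ᵈ pathᵈ 3F 4F 0F 1F) (n ∷ I ∷ S ∷ R ∷ [])
        ... | inj₂ ∄ = A , (λ u → ⇔.trans (A-spec u) (mk⇔ (widen u) (narrow u))) , A-fin
          where
          widen : ∀ u → Short n u → Short (succ M n) u
          widen u (u∈I , k , k∈n , u-path) = u∈I , k , insert-old k∈n , u-path
          narrow : ∀ u → Short (succ M n) u → Short n u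
          narrow u (u∈I , k , k∈ , u-path) with to (insert-spec n n k) k∈
          ... | inj₁ k∈n  = u∈I , k , k∈n , u-path
          ... | inj₂ refl = ⊥-elim (∄ (u , u∈I , u-path))
        ... | inj₁ (t , t∈I , t-path) =
          insert t A , (λ u → ⇔.trans (insert-spec t A u) (mk⇔ (fwd u) (bwd u))) ,
          insert-finite A-fin t∉A
          where
          t∉A : ¬ t ∈ A
          t∉A t∈A with to (A-spec t) t∈A
          ... | _ , k , k∈n , t-path′ =
            ∈-irrefl (subst (_∈ n) (function-domain-unique (proj₁ t-path′) (proj₁ t-path)) k∈n)
          fwd : ∀ u → u ∈ A ⊎ u ≡ t → Short (succ M n) u
          fwd u (inj₂ refl) = t∈I , n , insert-new , t-path
          fwd u (inj₁ u∈A) with to (A-spec u) u∈A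
          ... | u∈I , k , k∈n , u-path = u∈I , k , insert-old k∈n , u-path
          bwd : ∀ u → Short (succ M n) u → u ∈ A ⊎ u ≡ t
          bwd u (u∈I , k , k∈ , u-path) with to (insert-spec n n k) k∈
          ... | inj₁ k∈n  = inj₁ (from (A-spec u) (u∈I , k , k∈n , u-path))
          -- Here `u` and `t` both have length `n`; being comparable, they coincide.
          ... | inj₂ refl = inj₂ (Sum.[
            (λ u⊆t → ⊆-antisym u⊆t (path-⊆ u-path t-path (λ _ → id) u⊆t)) ,
            (λ t⊆u → ⊆-antisym (path-⊆ t-path u-path (λ _ → id) t⊆u) t⊆u) ] (total u t u∈I t∈I))

    bounded-chain-finite : ∀ {I} → Chain I → Bounded I → Finite M I
    bounded-chain-finite {I} chain (t , t∈V , t-max) with to (V-spec t) t∈V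
    ... | n , n∈ω , t-path with shorter-finite chain (succ M n) (succ∈ω n∈ω)
    ... | A , A-spec , A-fin = subst (Finite M) (⊆-antisym A⊆I I⊆A) A-fin
      where
      A⊆I : A ⊆ I
      A⊆I u u∈A = proj₁ (to (A-spec u) u∈A)
      I⊆A : I ⊆ A
      I⊆A u u∈I with to (V-spec u) (proj₁ chain u u∈I)
      ... | k , k∈ω , u-path = from (A-spec u) (u∈I , k , k≤n , u-path)
        where
        k≤n : k ∈ succ M n
        k≤n with ω-trichotomy k∈ω n∈ω
        ... | inj₁ k∈n         = insert-old k∈n
        ... | inj₂ (inj₁ refl) = insert-new
        ... | inj₂ (inj₂ n∈k)  = ⊥-elim (∈-irrefl (proj₁ (relation-∈ (proj₁ (proj₁ t-path))
                (t-max u u∈I _ (proj₂ (function-value (proj₁ u-path) n∈k))))))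

    -- Comparability puts any two pairs of the union into a common path, from which
    -- single-valuedness and the step condition are inherited. Unboundedness supplies a value at
    -- every index.
    chain-union-sequence : ∀ {I} → Chain I → Unbounded I →
      ∃ λ s → IsFunction M s (ω M) S ×
        (∀ n x y → n ∈ ω M → ⟪ n , x ⟫ ∈ s → ⟪ succ M n , y ⟫ ∈ s → ⟪ x , y ⟫ ∈ R)
    chain-union-sequence {I} (I⊆V , total) unbounded = ⋃ M I , (rel , tot) , steps
      where
      common : ∀ {p q} → p ∈ ⋃ M I → q ∈ ⋃ M I →
               ∃ λ t → (∃ λ n → n ∈ ω M × Path t n) × p ∈ t × q ∈ t
      common p∈ q∈ with to (union-spec I _) p∈ | to (union-spec I _) q∈
      ... | t , t∈I , p∈t | u , u∈I , q∈u with total t u t∈I u∈I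
      ... | inj₁ t⊆u = u , to (V-spec u) (I⊆V u u∈I) , t⊆u _ p∈t , q∈u
      ... | inj₂ u⊆t = t , to (V-spec t) (I⊆V t t∈I) , p∈t , u⊆t _ q∈u
      rel : IsRelation M (⋃ M I) (ω M) S
      rel p p∈ with common p∈ p∈
      ... | t , (n , n∈ω , (t-rel , _) , _) , p∈t , _ with t-rel p p∈t
      ... | k , x , k∈n , x∈S , e = k , x , ω-transitive n∈ω k∈n , x∈S , e
      tot : ∀ n → n ∈ ω M → ∃! _≡_ λ x → ⟪ n , x ⟫ ∈ ⋃ M I
      tot n n∈ω with unbounded n n∈ω
      ... | t , t∈I , x , nx = x , nx∈ , λ ny∈ → unique (common nx∈ ny∈)
        where
        nx∈ : ⟪ n , x ⟫ ∈ ⋃ M I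
        nx∈ = from (union-spec I _) (t , t∈I , nx)
        unique : ∀ {y} → (∃ λ t → (∃ λ k → k ∈ ω M × Path t k) × ⟪ n , x ⟫ ∈ t × ⟪ n , y ⟫ ∈ t) →
                 x ≡ y
        unique (_ , (_ , _ , t-fun , _) , nx , ny) = function-unique t-fun nx ny
      steps : ∀ n x y → n ∈ ω M → ⟪ n , x ⟫ ∈ ⋃ M I → ⟪ succ M n , y ⟫ ∈ ⋃ M I → ⟪ x , y ⟫ ∈ R
      steps n x y _ nx n⁺y with common nx n⁺y
      ... | _ , (_ , _ , _ , t-step) , nx∈t , n⁺y∈t = t-step n (succ M n) x y refl nx∈t n⁺y∈t

    -- Extending paths along a total relation

    module _ (S-inhabited : ∃ λ x → x ∈ S)
             (R-total : ∀ x → x ∈ S → ∃ λ y → y ∈ S × ⟪ x , y ⟫ ∈ R) where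

      -- For the empty path the condition is vacuous and any element of `S` will do; otherwise
      -- totality of `R` gives a successor of the last value.
      next-term : ∀ {t n} → n ∈ ω M → Path t n →
                  ∃ λ y → y ∈ S × (∀ k x → n ≡ succ M k → ⟪ k , x ⟫ ∈ t → ⟪ x , y ⟫ ∈ R)
      next-term n∈ω (t-fun , _) with ω-cases n∈ω
      ... | inj₁ refl = proj₁ S-inhabited , proj₂ S-inhabited ,
        λ k x _ kx → ⊥-elim (∅-empty k (proj₁ (relation-∈ (proj₁ t-fun) kx)))
      ... | inj₂ (j , _ , refl) with function-value t-fun insert-new
      ...   | z , jz with R-total z (proj₂ (relation-∈ (proj₁ t-fun) jz))
      ...     | y , y∈S , zRy = y , y∈S , related
        where
        related : ∀ k x → succ M j ≡ succ M k → ⟪ k , x ⟫ ∈ _ → ⟪ x , y ⟫ ∈ R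
        related k x e kx with succ-injective e
        ... | refl with function-unique t-fun jz kx
        ... | refl = zRy

      opaque
        extend-path : ∀ {t n} → n ∈ ω M → Path t n →
                      ∃ λ y → Path (insert ⟪ n , y ⟫ t) (succ M n)
        extend-path {t} {n} n∈ω t-path@(t-fun , t-step) with next-term n∈ω t-path
        ... | y , y∈S , last = y , insert-function t-fun ∈-irrefl (λ _ → id) y∈S , steps
          where
          steps : ∀ k k′ u v → k′ ≡ succ M k → ⟪ k , u ⟫ ∈ insert ⟪ n , y ⟫ t →
                  ⟪ k′ , v ⟫ ∈ insert ⟪ n , y ⟫ t → ⟪ u , v ⟫ ∈ R
          steps k _ u v refl ku k⁺v with insert-pair ku | insert-pair k⁺v
          -- Only the passage from an old entry to the new one needs `last`. A step starting at the
          -- new index `n` would require `succ M n` to be in `n` or equal to it.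
          ... | inj₁ ku∈t          | inj₁ k⁺v∈t         = t-step k _ u v refl ku∈t k⁺v∈t
          ... | inj₁ ku∈t          | inj₂ (refl , refl) = last k u refl ku∈t
          ... | inj₂ (refl , _)    | inj₁ k⁺v∈t         =
            ⊥-elim (∈-asym insert-new (proj₁ (relation-∈ (proj₁ t-fun) k⁺v∈t)))
          ... | inj₂ (refl , _)    | inj₂ (e , _)       = ⊥-elim (∈-irrefl (subst (n ∈_) e insert-new))

        path-exists : ∀ n → n ∈ ω M → ∃ λ t → Path t n
        path-exists = ω-induction (∃ᵈ pathᵈ 2F 3F 0F 1F) (S ∷ R ∷ []) (∅ M , empty-path)
          λ n n∈ω (t , t-path) → _ , proj₂ (extend-path n∈ω t-path)

      -- Finitely many paths would have a common bound `m` on their indices, but some path has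
      -- length `succ M m` and so uses the index `m`.
      pathGraph-infinite : Infinite M pathGraph
      pathGraph-infinite V-fin
        with separateRelation (∀ᵈ ∀ᵈ pair∈ᵈ 1F 0F 3F ⇒ᵈ 1F ∈ᵈ 2F) [] V (ω M)
      ... | q , _ , q-spec with finite-bound {q = q} V-fin bound mono
        where
        bound : ∀ t → t ∈ V → ∃ λ m → m ∈ ω M × ⟪ t , m ⟫ ∈ q
        bound t t∈V with to (V-spec t) t∈V
        ... | n , n∈ω , (t-rel , _) , _ =
          n , n∈ω , from (q-spec t n) (t∈V , n∈ω , λ k y ky → proj₁ (relation-∈ t-rel ky))
        mono : ∀ t m m′ → m′ ∈ ω M → m ∈ m′ → ⟪ t , m ⟫ ∈ q → ⟪ t , m′ ⟫ ∈ q
        mono t m m′ m′∈ω m∈m′ h with to (q-spec t m) h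
        ... | t∈V , _ , below =
          from (q-spec t m′) (t∈V , m′∈ω , λ k y ky → ∈-trans m′∈ω (below k y ky) m∈m′)
      ... | m , m∈ω , h with path-exists (succ M m) (succ∈ω m∈ω)
      ... | t , t-path with function-value (proj₁ t-path) insert-new
      ... | y , my = ∈-irrefl (proj₂ (proj₂ (to (q-spec t m)
              (h t (from (V-spec t) (_ , succ∈ω m∈ω , t-path))))) m y my)

      -- An extension of the bound `t` by one entry lies above every member of `I` and is itself not
      -- a member, so adding it gives a larger chain.
      maximal-unbounded : ∀ {I} → Maximal Chain I → ¬ Bounded I
      maximal-unbounded {I} ((I⊆V , total) , max) (t , t∈V , t-max) with to (V-spec t) t∈V
      ... | n , n∈ω , t-path with extend-path n∈ω t-path
      ... | y , t⁺-path = max (insert t⁺ I) (J⊆V , J-total) ((λ _ → insert-old) , I≢J)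
        where
        t⁺ : U
        t⁺ = insert ⟪ n , y ⟫ t
        J⊆V : insert t⁺ I ⊆ V
        J⊆V u u∈ with to (insert-spec _ _ u) u∈
        ... | inj₁ u∈I  = I⊆V u u∈I
        ... | inj₂ refl = from (V-spec _) (_ , succ∈ω n∈ω , t⁺-path)
        J-total : ∀ u v → u ∈ insert t⁺ I → v ∈ insert t⁺ I → u ⊆ v ⊎ v ⊆ u
        J-total u v u∈ v∈ with to (insert-spec _ _ u) u∈ | to (insert-spec _ _ v) v∈
        ... | inj₁ u∈I  | inj₁ v∈I  = total u v u∈I v∈I
        ... | inj₁ u∈I  | inj₂ refl = inj₁ λ p p∈u → insert-old (t-max u u∈I p p∈u)
        ... | inj₂ refl | inj₁ v∈I  = inj₂ λ p p∈v → insert-old (t-max v v∈I p p∈v)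
        ... | inj₂ refl | inj₂ refl = inj₁ λ _ → id
        I≢J : ¬ I ≡ insert t⁺ I
        -- Were the extension in `I`, it would lie below `t`, and `t` would have a value at its own
        -- length `n`.
        I≢J e = ∈-irrefl (proj₁ (relation-∈ (proj₁ (proj₁ t-path))
          (t-max t⁺ (subst (t⁺ ∈_) (sym e) insert-new) _ insert-new)))

  -- Dependent choice from maximal independent sets

  independent⇒dependentChoice : MaximalIndependent M → DC M
  independent⇒dependentChoice mi S R S-inhabited _ R-total =
    Sum.[ fromUnbounded , fromMaximal ]′
      -- The existence of an unbounded chain is decided first: such a chain gives the sequence
      -- outright, and its absence makes all independent sets finite, as the graph statement
      -- demands.
      (em (∃ᵈ (0F ⊆ᵈ 1F ∧ᵈ (∀ᵈ ∀ᵈ 1F ∈ᵈ 2F ⇒ᵈ 0F ∈ᵈ 2F ⇒ᵈ 1F ⊆ᵈ 0F ∨ᵈ 0F ⊆ᵈ 1F))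
             ∧ᵈ (∀ᵈ 0F ∈ᵈ 3F ⇒ᵈ (∃ᵈ 0F ∈ᵈ 2F ∧ᵈ (∃ᵈ pair∈ᵈ 2F 0F 1F))))
          (V S R ∷ ω M ∷ []))
    where
    Sequence : Set ℓ
    Sequence = ∃ λ s → IsFunction M s (ω M) S ×
      (∀ n x y → n ∈ ω M → ⟪ n , x ⟫ ∈ s → ⟪ succ M n , y ⟫ ∈ s → ⟪ x , y ⟫ ∈ R)
    fromUnbounded : (∃ λ I → Chain S R I × Unbounded S R I) → Sequence
    fromUnbounded (_ , chain , unbounded) = chain-union-sequence S R chain unbounded
    finite : ¬ (∃ λ I → Chain S R I × Unbounded S R I) →
             ∀ {I} → Chain S R I → Finite M I
    finite ∄ chain = Sum.[ (λ unbounded → ⊥-elim (∄ (_ , chain , unbounded)))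
                         , bounded-chain-finite S R chain ] (unbounded-or-bounded S R chain)
    sequence : ∀ {I} → Maximal (Chain S R) I → Sequence
    sequence max@(chain , _) = Sum.[ chain-union-sequence S R chain
      , ⊥-elim ∘ maximal-unbounded S R S-inhabited R-total max ] (unbounded-or-bounded S R chain)
    fromMaximal : ¬ (∃ λ I → Chain S R I × Unbounded S R I) → Sequence
    fromMaximal ∄ =
      let I , I-max = mi (pathGraph S R) (pathGraph-infinite S R S-inhabited R-total)
                         (λ I ind → finite ∄ (to (independent⇔chain S R I) ind))
      in sequence (maximal-resp (independent⇔chain S R) I-max)

theorem3p6 : ∀ {ℓ} (M : ZF ℓ) →
    (DC M ⇔ MaximalZeroMonochromatic M) ×
    (MaximalZeroMonochromatic M ⇔ MaximalIndependent M)
theorem3p6 M =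
  mk⇔ (dependentChoice⇒mono M) (independent⇒dependentChoice M ∘ mono⇒independent M) ,
  mk⇔ (mono⇒independent M) (independent⇒mono M)
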